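{- There exists a positive constant $c$ such that for every integer $k\geq 2$ and every graph $G$ with $\operatorname{pw}(G)\geq ck^5\log^{5/2}(k)$, we have $\operatorname{pw}(G\times K_2)\geq k$.
   Context: All graphs are finite and simple. $\operatorname{pw}$ denotes pathwidth. The direct product $G\times K_2$ has vertex set $V(G)\times V(K_2)$, with $(a,v)(b,u)$ an edge iff $ab\in E(G)$ and $uv\in E(K_2)$. -}

module Defs where

open import Data.Bool using (Bool; true; false)
open import Data.Nat using (ℕ; zero; suc; _∸_; _⊔_)
open import Data.Fin using (Fin; splitAt; _≤_)
open import Data.Fin.Subset using (Subset; _∈_; ∣_∣)
open import Data.List using (foldr; map; allFin)
open import Data.Product using (∃; _×_)
open import Data.Sum using (_⊎_; inj₁; inj₂)
open import Relation.Binary.PropositionalEquality using (_≡_; refl)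

record Graph : Set where
  field
    n     : ℕ
    adj   : Fin n → Fin n → Bool
    sym   : ∀ u v → adj u v ≡ adj v u
    loopless : ∀ v → adj v v ≡ false

open Graph public

Edge : (G : Graph) → Fin (n G) → Fin (n G) → Set
Edge G u v = adj G u v ≡ true

-- Direct product G × K₂. Vertex set Fin (n + n): x with splitAt n x = inj₁ a
-- is (a , 0), and inj₂ a is (a , 1).  (a,i)(b,j) is an edge iff ab ∈ E(G) and i ≠ j.
×K₂-adj : (G : Graph) → Fin (n G Data.Nat.+ n G) → Fin (n G Data.Nat.+ n G) → Bool
×K₂-adj G x y with splitAt (n G) x | splitAt (n G) y
... | inj₁ a | inj₂ b = adj G a b
... | inj₂ a | inj₁ b = adj G a b
... | inj₁ _ | inj₁ _ = false
... | inj₂ _ | inj₂ _ = false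

×K₂-sym : (G : Graph) → ∀ x y → ×K₂-adj G x y ≡ ×K₂-adj G y x
×K₂-sym G x y with splitAt (n G) x | splitAt (n G) y
... | inj₁ a | inj₂ b = sym G a b
... | inj₂ a | inj₁ b = sym G a b
... | inj₁ _ | inj₁ _ = refl
... | inj₂ _ | inj₂ _ = refl

×K₂-loopless : (G : Graph) → ∀ x → ×K₂-adj G x x ≡ false
×K₂-loopless G x with splitAt (n G) x
... | inj₁ _ = refl
... | inj₂ _ = refl

_×K₂ : Graph → Graph
G ×K₂ = record
  { n = n G Data.Nat.+ n G
  ; adj = ×K₂-adj G
  ; sym = ×K₂-sym G
  ; loopless = ×K₂-loopless G
  }

record PathDecomposition (G : Graph) : Set where
  field
    len     : ℕ
    bag     : Fin len → Subset (n G)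
    covers  : ∀ v → ∃ λ i → v ∈ bag i
    edges   : ∀ u v → Edge G u v → ∃ λ i → (u ∈ bag i) × (v ∈ bag i)
    interp  : ∀ i j l v → i ≤ j → j ≤ l → v ∈ bag i → v ∈ bag l → v ∈ bag j

open PathDecomposition public

width : {G : Graph} → PathDecomposition G → ℕ
width D = foldr _⊔_ 0 (map (λ i → ∣ bag D i ∣ ∸ 1) (allFin (len D)))

-- pw(G) ≥ t  ⇔  every path decomposition of G has width ≥ t
-- (pw is the minimum width over all path decompositions).
pw≥ : Graph → ℕ → Set
pw≥ G t = (D : PathDecomposition G) → t Data.Nat.≤ width D

{-# OPTIONS --safe #-}

-- In fact pw(G) ≤ pw(G × K₂), so c = 0 will do. Take a path decomposition of
-- G × K₂; every copy (v , i) of a vertex v occupies an interval of bags. Let v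
-- occupy both intervals if they meet, and otherwise only the earlier one; the
-- bags do not grow. Let uv be an edge. If u keeps both copies, or if u and v keep
-- copies of opposite parity, then the bag of an edge above uv contains kept copies
-- of u and v. If both keep only copy i, let s contain (u , i), (v , 1 - i) and t
-- contain (u , 1 - i), (v , i): u gives s < t, and v gives t < s, a contradiction.
module Submission where

open import Defs
open import Data.Bool using (Bool; true; false; not) renaming (_≟_ to _≟ᵇ_)
open import Data.Bool.Properties using (¬-not)
open import Data.Empty using (⊥-elim)
open import Data.Fin using (Fin; toℕ; _↑ˡ_; _↑ʳ_) renaming (_<_ to _<ᶠ_; _≤_ to _≤ᶠ_)
open import Data.Fin.Properties using (splitAt-↑ˡ; splitAt-↑ʳ; any?) renaming (<-cmp to <ᶠ-cmp)
open import Data.Fin.Subset using (Subset; _∈_; _⊆_; ∣_∣; _∪_; inside; outside)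
open import Data.Fin.Subset.Properties using (_∈?_; p⊆q⇒∣p∣≤∣q∣; x∈p∪q⁺)
open import Data.List using ([]; _∷_; foldr; map; allFin)
open import Data.Nat using (ℕ; zero; suc; _+_; _*_; _^_; _≤_; _⊔_; z≤n; s≤s; NonZero; >-nonZero)
open import Data.Nat.Logarithm using (⌊log₂_⌋; ⌊log₂⌋-mono-≤)
open import Data.Nat.Properties
open import Data.Product using (Σ; ∃; _×_; _,_)
open import Data.Sum using (_⊎_; inj₁; inj₂)
open import Data.Unit using (⊤; tt)
open import Data.Vec using ([]; _∷_; tabulate; lookup)
open import Data.Vec.Properties using (tabulate∘lookup; lookup∘tabulate; lookup⇒[]=; []=⇒lookup)
open import Function using (_∘_)
open import Relation.Binary.Definitions using (tri<; tri≈; tri>)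
open import Relation.Binary.PropositionalEquality using (_≡_; refl; trans; cong) renaming (sym to ≡-sym)
open import Relation.Nullary using (¬_; Dec; yes; no; does)
open import Relation.Nullary.Decidable using (_×-dec_; _⊎-dec_; map′; dec-true)

-- Finite subsets, cardinalities and maxima

module _ {n : ℕ} {P : Fin n → Set} (P? : ∀ v → Dec (P v)) where

  comprehension : Subset n
  comprehension = tabulate (does ∘ P?)

  ∈-comprehension⁺ : ∀ {v} → P v → v ∈ comprehension
  ∈-comprehension⁺ {v} p =
    lookup⇒[]= v comprehension (trans (lookup∘tabulate _ v) (dec-true (P? v) p))

  ∈-comprehension⁻ : ∀ {v} → v ∈ comprehension → P v
  ∈-comprehension⁻ {v} v∈ with P? v | trans (≡-sym (lookup∘tabulate (does ∘ P?) v)) ([]=⇒lookup v∈)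
  ... | yes p | _  = p
  ... | no  _ | ()

∣p∪q∣≤∣p∣+∣q∣ : ∀ {n} (p q : Subset n) → ∣ p ∪ q ∣ ≤ ∣ p ∣ + ∣ q ∣
∣p∪q∣≤∣p∣+∣q∣ [] [] = z≤n
∣p∪q∣≤∣p∣+∣q∣ (outside ∷ p) (outside ∷ q) = ∣p∪q∣≤∣p∣+∣q∣ p q
∣p∪q∣≤∣p∣+∣q∣ (inside  ∷ p) (outside ∷ q) = s≤s (∣p∪q∣≤∣p∣+∣q∣ p q)
∣p∪q∣≤∣p∣+∣q∣ (outside ∷ p) (inside  ∷ q) =
  ≤-trans (s≤s (∣p∪q∣≤∣p∣+∣q∣ p q)) (≤-reflexive (≡-sym (+-suc ∣ p ∣ ∣ q ∣)))
∣p∪q∣≤∣p∣+∣q∣ (inside  ∷ p) (inside  ∷ q) =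
  s≤s (≤-trans (∣p∪q∣≤∣p∣+∣q∣ p q) (+-monoʳ-≤ ∣ p ∣ (n≤1+n ∣ q ∣)))

restrictˡ : ∀ m {n} → Subset (m + n) → Subset m
restrictˡ m {n} p = tabulate (λ v → lookup p (v ↑ˡ n))

restrictʳ : ∀ m {n} → Subset (m + n) → Subset n
restrictʳ m p = tabulate (λ v → lookup p (m ↑ʳ v))

∣restrict∣ : ∀ m {n} (p : Subset (m + n)) → ∣ restrictˡ m p ∣ + ∣ restrictʳ m p ∣ ≡ ∣ p ∣
∣restrict∣ zero    p             = cong ∣_∣ (tabulate∘lookup p)
∣restrict∣ (suc m) (inside  ∷ p) = cong suc (∣restrict∣ m p)
∣restrict∣ (suc m) (outside ∷ p) = ∣restrict∣ m p

foldr-⊔-mono : ∀ {A : Set} {f g : A → ℕ} → (∀ x → f x ≤ g x) →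
               ∀ xs → foldr _⊔_ 0 (map f xs) ≤ foldr _⊔_ 0 (map g xs)
foldr-⊔-mono f≤g []       = z≤n
foldr-⊔-mono f≤g (x ∷ xs) = ⊔-mono-≤ (f≤g x) (foldr-⊔-mono f≤g xs)

-- Relative position of two vertices in a path decomposition

module Intervals {H : Graph} (D : PathDecomposition H) where

  Meet : Fin (n H) → Fin (n H) → Set
  Meet x y = ∃ λ t → x ∈ bag D t × y ∈ bag D t

  Before : Fin (n H) → Fin (n H) → Set
  Before x y = ∀ {s t} → x ∈ bag D s → y ∈ bag D t → s <ᶠ t

  -- A pair in the wrong order, `t < s`, would force a common bag. If `t ≤ s₀`, then `y` spans from
  -- `t` to `t₀` and meets `x` at `s₀`; if `s₀ ≤ t`, then `x` spans from `s₀` to `s` and meets `y`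
  -- at `t`.
  before-extend : ∀ {x y s₀ t₀} → ¬ Meet x y →
                  x ∈ bag D s₀ → y ∈ bag D t₀ → s₀ <ᶠ t₀ → Before x y
  before-extend {x} {y} {s₀} {t₀} disjoint x∈s₀ y∈t₀ s₀<t₀ {s} {t} x∈s y∈t
    with <ᶠ-cmp s t
  ... | tri< s<t _ _  = s<t
  ... | tri≈ _ refl _ = ⊥-elim (disjoint (s , x∈s , y∈t))
  ... | tri> _ _ t<s with ≤-total (toℕ t) (toℕ s₀)
  ...   | inj₁ t≤s₀ = ⊥-elim (disjoint (s₀ , x∈s₀ , interp D t s₀ t₀ y t≤s₀ (<⇒≤ s₀<t₀) y∈t y∈t₀))
  ...   | inj₂ s₀≤t = ⊥-elim (disjoint (t , interp D s₀ t s x s₀≤t (<⇒≤ t<s) x∈s₀ x∈s , y∈t))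

  meet-or-before : ∀ x y → Meet x y ⊎ Before x y ⊎ Before y x
  meet-or-before x y with any? (λ t → (x ∈? bag D t) ×-dec (y ∈? bag D t))
  ... | yes meet    = inj₁ meet
  -- One sample bag for each vertex suffices: `before-extend` carries their order over to all other
  -- occurrences.
  ... | no disjoint with covers D x | covers D y
  ...   | s , x∈s | t , y∈t with <ᶠ-cmp s t
  ...     | tri< s<t _ _  = inj₂ (inj₁ (before-extend disjoint x∈s y∈t s<t))
  ...     | tri≈ _ refl _ = inj₁ (s , x∈s , y∈t)
  ...     | tri> _ _ t<s  =
    inj₂ (inj₂ (before-extend (λ (r , y∈r , x∈r) → disjoint (r , x∈r , y∈r)) y∈t x∈s t<s))

-- From decompositions of the product to decompositions of the factor

copy : (G : Graph) → Bool → Fin (n G) → Fin (n (G ×K₂))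
copy G false v = v ↑ˡ n G
copy G true  v = n G ↑ʳ v

copy-edge : ∀ G {u v} → Edge G u v → ∀ i → Edge (G ×K₂) (copy G i u) (copy G (not i) v)
copy-edge G {u} {v} e false rewrite splitAt-↑ˡ (n G) u (n G) | splitAt-↑ʳ (n G) (n G) v = e
copy-edge G {u} {v} e true  rewrite splitAt-↑ˡ (n G) v (n G) | splitAt-↑ʳ (n G) (n G) u = e

module Projection (G : Graph) (D : PathDecomposition (G ×K₂)) where

  open Intervals D

  -- Each case keeps its evidence: the common bag `t` later glues the two intervals into one, and
  -- the strict order excludes two conflicting choices on an edge.
  data Selection (v : Fin (n G)) : Set where
    both    : ∀ t → (∀ i → copy G i v ∈ bag D t) → Selection v
    earlier : ∀ i → Before (copy G i v) (copy G (not i) v) → Selection v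

  Selected : ∀ {v} → Selection v → Bool → Set
  Selected (both _ _)    j = ⊤
  Selected (earlier i _) j = i ≡ j

  selected? : ∀ {v} (σ : Selection v) j → Dec (Selected σ j)
  selected? (both _ _)    j = yes tt
  selected? (earlier i _) j = i ≟ᵇ j

  selected : ∀ {v} (σ : Selection v) → ∃ (Selected σ)
  selected (both _ _)    = false , tt
  selected (earlier i _) = i , refl

  selection : ∀ v → Selection v
  selection v with meet-or-before (copy G false v) (copy G true v)
  ... | inj₁ (t , v₀∈t , v₁∈t) = both t λ { false → v₀∈t ; true → v₁∈t }
  ... | inj₂ (inj₁ v₀<v₁)      = earlier false v₀<v₁
  ... | inj₂ (inj₂ v₁<v₀)      = earlier true v₁<v₀

  Occupies : Fin (len D) → Fin (n G) → Set
  Occupies t v = ∃ λ i → Selected (selection v) i × copy G i v ∈ bag D t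

  occupies? : ∀ t v → Dec (Occupies t v)
  occupies? t v = map′ (λ { (inj₁ p) → false , p ; (inj₂ p) → true , p })
                       (λ { (false , p) → inj₁ p ; (true , p) → inj₂ p })
                       (at false ⊎-dec at true)
    where
    at : ∀ i → Dec (Selected (selection v) i × copy G i v ∈ bag D t)
    at i = selected? (selection v) i ×-dec (copy G i v ∈? bag D t)

  occupies-covers : ∀ v → ∃ λ t → Occupies t v
  occupies-covers v with selected (selection v)
  ... | i , sel with covers D (copy G i v)
  ...   | t , v∈t = t , i , sel , v∈t

  copies-meet : ∀ {u v} → Edge G u v → ∀ i → Meet (copy G i u) (copy G (not i) v)
  copies-meet e i = edges D _ _ (copy-edge G e i)

  selections-meet : ∀ {u v} → Edge G u v → (σ : Selection u) (τ : Selection v) →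
    ∃ λ t → (∃ λ i → Selected σ i × copy G i u ∈ bag D t) ×
            (∃ λ i → Selected τ i × copy G i v ∈ bag D t)
  selections-meet {u} {v} e σ (both _ _) with selected σ
  ... | i , sel with copies-meet e i
  ...   | t , u∈t , v∈t = t , (i , sel , u∈t) , (not i , tt , v∈t)
  -- Here `v` dictates the copy, so the edge is reversed and lifted from `copy G j v`.
  selections-meet {u} {v} e (both _ _) (earlier j _) with copies-meet (trans (sym G v u) e) j
  ... | t , v∈t , u∈t = t , (not j , tt , u∈t) , (j , refl , v∈t)
  selections-meet {u} {v} e (earlier i u<) (earlier j v<) with j ≟ᵇ i
  ... | no j≢i with copies-meet e i
  -- For booleans, `j≢i` gives `j ≡ not i`: the far end of the lifted edge is exactly the copy that
  -- `v` keeps.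
  ...   | t , u∈t , v∈t = t , (i , refl , u∈t) , (not i , ¬-not j≢i , v∈t)
  selections-meet {u} {v} e (earlier i u<) (earlier i v<) | yes refl
    with copies-meet e i | copies-meet (trans (sym G v u) e) i
  ... | s , u∈s , v∈s | t , v∈t , u∈t = ⊥-elim (<-asym (u< u∈s u∈t) (v< v∈t v∈s))

  selection-interp : ∀ {v} (σ : Selection v) {i j} → Selected σ i → Selected σ j →
    ∀ {r s t} → r ≤ᶠ s → s ≤ᶠ t → copy G i v ∈ bag D r → copy G j v ∈ bag D t →
    ∃ λ l → Selected σ l × copy G l v ∈ bag D s
  selection-interp (earlier i _) refl refl r≤s s≤t v∈r v∈t =
    i , refl , interp D _ _ _ _ r≤s s≤t v∈r v∈t
  -- The occurrences at `r` and `t` may be of different copies, but bag `m` contains both. Before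
  -- `m`, copy `i` persists from `r`; after `m`, copy `j` persists up to `t`.
  selection-interp (both m v∈m) {i} {j} _ _ {s = s} r≤s s≤t v∈r v∈t
    with ≤-total (toℕ s) (toℕ m)
  ... | inj₁ s≤m = i , tt , interp D _ _ _ _ r≤s s≤m v∈r (v∈m i)
  ... | inj₂ m≤s = j , tt , interp D _ _ _ _ m≤s s≤t (v∈m j) v∈t

  project : PathDecomposition G
  project = record
    { len    = len D
    ; bag    = λ t → comprehension (occupies? t)
    ; covers = λ v → let t , occ = occupies-covers v in t , ∈-comprehension⁺ (occupies? t) occ
    ; edges  = λ u v e →
        let t , u-occ , v-occ = selections-meet e (selection u) (selection v)
        in t , ∈-comprehension⁺ (occupies? t) u-occ , ∈-comprehension⁺ (occupies? t) v-occ
    ; interp = λ r s t v r≤s s≤t v∈r v∈t →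
        let _ , sel , c∈r  = ∈-comprehension⁻ (occupies? r) v∈r
            _ , sel′ , c∈t = ∈-comprehension⁻ (occupies? t) v∈t
        in ∈-comprehension⁺ (occupies? s) (selection-interp (selection v) sel sel′ r≤s s≤t c∈r c∈t)
    }

  -- Every vertex in the new bag has a copy in the old one, and `L` and `R` count the two layers of
  -- the old bag separately.
  ∣bag-project∣≤∣bag∣ : ∀ t → ∣ bag project t ∣ ≤ ∣ bag D t ∣
  ∣bag-project∣≤∣bag∣ t = begin
    ∣ bag project t ∣      ≤⟨ p⊆q⇒∣p∣≤∣q∣ bag⊆ ⟩
    ∣ L ∪ R ∣              ≤⟨ ∣p∪q∣≤∣p∣+∣q∣ L R ⟩
    ∣ L ∣ + ∣ R ∣          ≡⟨ ∣restrict∣ (n G) (bag D t) ⟩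
    ∣ bag D t ∣            ∎
    where
    open ≤-Reasoning
    L R : Subset (n G)
    L = restrictˡ (n G) (bag D t)
    R = restrictʳ (n G) (bag D t)
    bag⊆ : bag project t ⊆ L ∪ R
    bag⊆ {v} v∈ with ∈-comprehension⁻ (occupies? t) v∈
    ... | false , _ , c∈ =
      x∈p∪q⁺ (inj₁ (lookup⇒[]= v L (trans (lookup∘tabulate _ v) ([]=⇒lookup c∈))))
    ... | true  , _ , c∈ =
      x∈p∪q⁺ (inj₂ (lookup⇒[]= v R (trans (lookup∘tabulate _ v) ([]=⇒lookup c∈))))

  width-project≤width : width project ≤ width D
  width-project≤width = foldr-⊔-mono (λ t → ∸-monoˡ-≤ 1 (∣bag-project∣≤∣bag∣ t)) (allFin (len D))

-- Numerical bound and conclusion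

k²≤k¹⁰log⁵k : ∀ k → 2 ≤ k → k ^ 2 ≤ 1 * k ^ 10 * ⌊log₂ k ⌋ ^ 5
k²≤k¹⁰log⁵k k 2≤k = begin
  k ^ 2                          ≤⟨ ^-monoʳ-≤ k {2} {10} (s≤s (s≤s z≤n)) ⟩
  k ^ 10                         ≡⟨ *-identityˡ (k ^ 10) ⟨
  -- The logarithmic factor is at least 1, since `k ≥ 2` and `⌊log₂ 2⌋` is 1. The leading `1` is
  -- `suc c` at `c = 0`.
  1 * k ^ 10                     ≤⟨ m≤m*n (1 * k ^ 10) (⌊log₂ k ⌋ ^ 5) ⟩
  1 * k ^ 10 * ⌊log₂ k ⌋ ^ 5     ∎
  where
  open ≤-Reasoning
  instance
    k≢0 : NonZero k
    k≢0 = >-nonZero (<⇒≤ 2≤k)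
    log≢0 : NonZero ⌊log₂ k ⌋
    log≢0 = >-nonZero (⌊log₂⌋-mono-≤ 2≤k)
    log⁵≢0 : NonZero (⌊log₂ k ⌋ ^ 5)
    log⁵≢0 = m^n≢0 ⌊log₂ k ⌋ 5

-- Squaring the bound on the width clears the exponent 5/2, so all quantities are natural numbers;
-- `suc c` is the square of the constant and is thus positive.
theorem42 : Σ ℕ λ c → ∀ (k : ℕ) → 2 ≤ k → (G : Graph) →
    ((D : PathDecomposition G) → suc c * k ^ 10 * ⌊log₂ k ⌋ ^ 5 ≤ width D ^ 2) →
    pw≥ (G ×K₂) k
theorem42 = 0 , λ k 2≤k G large D →
  let open Projection G D
      -- The assumed bound is applied to the projected decomposition only; squares are compared
      -- first, and `k≤width` follows because squaring is strictly monotone.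
      k²≤width² = ≤-trans (k²≤k¹⁰log⁵k k 2≤k) (large project)
      k≤width   = ≮⇒≥ (λ width<k → <⇒≱ (^-monoˡ-< 2 width<k) k²≤width²)
  in ≤-trans k≤width width-project≤width
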